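{- Let $p,q,r\in\mathbf{Q}_{>0}$ be such that at least two among $p,q,r$ are integers. Then $$\mathsf{F}(p+q)\,\mathsf{F}(p+r)-\mathsf{F}(p)\,\mathsf{F}(p+q+r)=\mathrm{cds}(p)\,\mathsf{F}(q)\,\mathsf{F}(r).$$
   Context: The codenominator $\mathsf{F}:\mathbf{Q}_{>0}\to\mathbf{Z}_{>0}$ is the unique function with $\mathsf{F}(1)=1$ satisfying, for all $x\in\mathbf{Q}_{>0}$, $\mathsf{F}(1+1/x)=\mathsf{F}(x)$ and $\mathsf{F}\left(\frac{1}{1+x}\right)=\mathsf{F}(x)+\mathsf{F}(1/x)$. The codiscriminant $\mathrm{cds}:\mathbf{Q}_{>0}\to\mathbf{Z}$ is defined by $\mathrm{cds}(x):=\mathsf{F}(1/x)^2-\mathsf{F}(x)\mathsf{F}(1/x)-\mathsf{F}(x)^2$. -}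

module Defs where

open import Data.Nat.Base as ℕ using (ℕ; zero; suc)
import Data.Nat.Properties as ℕₚ
open import Data.Nat.Coprimality using (Coprime; coprime-+; sym)
open import Data.Integer.Base as ℤ using (ℤ; +_; +[1+_]; 1ℤ)
open import Data.Nat.Divisibility using (_∣_; ∣m∣n⇒∣m+n; ∣-refl)
import Data.Integer.Properties as ℤₚ
open import Data.Rational.Base as ℚ using (ℚ; mkℚ; 1ℚ; toℚᵘ)
import Data.Rational.Properties as ℚₚ
import Data.Rational.Unnormalised.Base as ℚᵘ
import Data.Rational.Unnormalised.Properties as ℚᵘₚ
open import Data.Empty using (⊥; ⊥-elim-irr)
open import Data.Product.Base using (∃-syntax; _×_; _,_; proj₁; proj₂; swap)
open import Data.Sum.Base using (_⊎_)
open import Function.Base using (_∘_)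
open import Relation.Binary.PropositionalEquality as ≡
  using (_≡_; _≗_; refl; cong; cong₂; subst; trans)

infixl 6 _+_
infix 8 1/_

-- Positivity is irrelevant, so equality in ℚ⁺ is equality of values.
record ℚ⁺ : Set where
  constructor mkℚ⁺
  field
    value       : ℚ
    .{{value>0}} : ℚ.Positive value

open ℚ⁺ public using (value)

1ℚ⁺ : ℚ⁺
1ℚ⁺ = mkℚ⁺ 1ℚ

_+_ : ℚ⁺ → ℚ⁺ → ℚ⁺
mkℚ⁺ x + mkℚ⁺ y = mkℚ⁺ (x ℚ.+ y) {{ℚₚ.pos+pos⇒pos x y}}

1/_ : ℚ⁺ → ℚ⁺
1/ mkℚ⁺ x = mkℚ⁺ ((ℚ.1/ x) {{ℚₚ.pos⇒nonZero x}}) {{ℚₚ.1/pos⇒pos x}}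

IsInteger : ℚ⁺ → Set
IsInteger x = ∃[ n ] value x ≡ n ℚ./ 1

AtLeastTwoIntegers : ℚ⁺ → ℚ⁺ → ℚ⁺ → Set
AtLeastTwoIntegers p q r =
  (IsInteger p × IsInteger q) ⊎ (IsInteger p × IsInteger r) ⊎ (IsInteger q × IsInteger r)

record IsCodenominator (F : ℚ⁺ → ℤ) : Set where
  field
    F>0      : ∀ x → ℤ.Positive (F x)
    F1       : F 1ℚ⁺ ≡ 1ℤ
    F[1+1/x] : ∀ x → F (1ℚ⁺ + 1/ x) ≡ F x
    F[1/1+x] : ∀ x → F (1/ (1ℚ⁺ + x)) ≡ F x ℤ.+ F (1/ x)

cds : (ℚ⁺ → ℤ) → ℚ⁺ → ℤ
cds F x = F (1/ x) ℤ.^ 2 ℤ.- F x ℤ.* F (1/ x) ℤ.- F x ℤ.^ 2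

-- The rest shows that there is exactly one codenominator.

private
  1/1+_ : ℕ × ℕ → ℕ × ℕ
  1/1+ (u , v) = v , u ℕ.+ v

  -- Subtractive Euclid with fuel k: yields (F (a/b) , F (b/a)) if 0 < a, 0 < b and a + b ≤ k.
  euclid : (k a b : ℕ) → ℕ × ℕ
  euclid zero    a b = 1 , 1
  euclid (suc k) a b with ℕ.compare a b
  ... | ℕ.equal _     = 1 , 1
  ... | ℕ.greater b d = 1/1+ euclid k (suc d) b
  ... | ℕ.less a d    = swap (1/1+ euclid k (suc d) a)

  compare-equal : ∀ a → ℕ.compare a a ≡ ℕ.equal a
  compare-equal zero    = refl
  compare-equal (suc a) rewrite compare-equal a = refl

  compare-greater : ∀ b d → ℕ.compare (suc (b ℕ.+ d)) b ≡ ℕ.greater b d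
  compare-greater zero    d = refl
  compare-greater (suc b) d rewrite compare-greater b d = refl

  compare-less : ∀ a d → ℕ.compare a (suc (a ℕ.+ d)) ≡ ℕ.less a d
  compare-less zero    d = refl
  compare-less (suc a) d rewrite compare-less a d = refl

  euclid-swap : ∀ k a b → euclid k b a ≡ swap (euclid k a b)
  euclid-swap zero    a b = refl
  euclid-swap (suc k) a b with ℕ.compare a b
  ... | ℕ.equal _     rewrite compare-equal a     = refl
  ... | ℕ.greater b d rewrite compare-less b d    = refl
  ... | ℕ.less a d    rewrite compare-greater a d = refl

  smaller : ∀ {k} b d → suc (suc (b ℕ.+ d)) ℕ.+ suc b ℕ.≤ suc k → suc d ℕ.+ suc b ℕ.≤ k
  smaller b d (ℕ.s≤s le) = ℕₚ.≤-trans (ℕₚ.+-monoˡ-≤ (suc b) (ℕ.s≤s (ℕₚ.m≤n+m d b))) le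

  smaller′ : ∀ {k} a d → suc a ℕ.+ suc (suc (a ℕ.+ d)) ℕ.≤ suc k → suc d ℕ.+ suc a ℕ.≤ k
  smaller′ {k} a d le = smaller a d (subst (ℕ._≤ suc k) (ℕₚ.+-comm (suc a) _) le)

  euclid-fuel : ∀ k l a b → suc a ℕ.+ suc b ℕ.≤ k → suc a ℕ.+ suc b ℕ.≤ l →
                euclid k (suc a) (suc b) ≡ euclid l (suc a) (suc b)
  euclid-fuel (suc k) (suc l) a b p q with ℕ.compare a b
  ... | ℕ.equal _     = refl
  ... | ℕ.greater b d = cong 1/1+_ (euclid-fuel k l d b (smaller b d p) (smaller b d q))
  ... | ℕ.less a d    =
    cong (swap ∘ 1/1+_) (euclid-fuel k l d a (smaller′ a d p) (smaller′ a d q))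

  Pos² : ℕ × ℕ → Set
  Pos² (u , v) = 0 ℕ.< u × 0 ℕ.< v

  euclid-pos : ∀ k a b → Pos² (euclid k a b)
  euclid-pos zero    a b = ℕ.s≤s ℕ.z≤n , ℕ.s≤s ℕ.z≤n
  euclid-pos (suc k) a b with ℕ.compare a b
  ... | ℕ.equal _     = ℕ.s≤s ℕ.z≤n , ℕ.s≤s ℕ.z≤n
  ... | ℕ.greater b d with u>0 , v>0 ← euclid-pos k (suc d) b =
    v>0 , ℕₚ.<-≤-trans u>0 (ℕₚ.m≤m+n _ _)
  ... | ℕ.less a d    with u>0 , v>0 ← euclid-pos k (suc d) a =
    ℕₚ.<-≤-trans u>0 (ℕₚ.m≤m+n _ _) , v>0

  φ : ℕ → ℕ → ℕ × ℕ
  φ a b = euclid (a ℕ.+ b) a b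

  φ-pos : ∀ a b → Pos² (φ a b)
  φ-pos a b = euclid-pos (a ℕ.+ b) a b

  φ-swap : ∀ a b → φ b a ≡ swap (φ a b)
  φ-swap a b rewrite ℕₚ.+-comm b a = euclid-swap (a ℕ.+ b) a b

  φ-1+ : ∀ a b → φ (suc (suc b ℕ.+ a)) (suc b) ≡ 1/1+ φ (suc a) (suc b)
  φ-1+ a b rewrite compare-greater b a =
    cong 1/1+_ (euclid-fuel _ _ a b (smaller b a ℕₚ.≤-refl) ℕₚ.≤-refl)

  frac : ∀ a b → .(Coprime (suc a) (suc b)) → ℚ⁺
  frac a b c = mkℚ⁺ (mkℚ +[1+ a ] b c)

  coprime-1+ : ∀ {a b} → Coprime (suc a) (suc b) → Coprime (suc (suc b ℕ.+ a)) (suc b)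
  coprime-1+ {a} {b} c = subst (λ n → Coprime n (suc b)) (ℕₚ.+-suc (suc b) a) (coprime-+ c)

  coprime-1+⁻¹ : ∀ {a b} → Coprime (suc (suc b ℕ.+ a)) (suc b) → Coprime (suc a) (suc b)
  coprime-1+⁻¹ {a} {b} c {d} (d∣a , d∣b) =
    c (subst (d ∣_) (ℕₚ.+-suc (suc b) a) (∣m∣n⇒∣m+n d∣b d∣a) , d∣b)

  ℚ⁺-≡ : ∀ {x y} → value x ≡ value y → x ≡ y
  ℚ⁺-≡ refl = refl

  1+frac : ∀ a b .(c : Coprime (suc a) (suc b)) →
           1ℚ⁺ + frac a b c ≡ frac (suc b ℕ.+ a) b (coprime-1+ c)
  1+frac a b c = ℚ⁺-≡ (ℚₚ.toℚᵘ-injective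
    (ℚᵘₚ.≃-trans (ℚₚ.toℚᵘ-homo-+ 1ℚ (value (frac a b c))) 
      (ℚᵘ.*≡* (cong₂ ℤ._*_ numerator denominator))))
    where
    numerator : 1ℤ ℤ.* (+ suc b) ℤ.+ (+ suc a) ℤ.* 1ℤ ≡ + suc (suc b ℕ.+ a)
    numerator = trans
      (cong₂ ℤ._+_ (ℤₚ.*-identityˡ (+ suc b)) (ℤₚ.*-identityʳ (+ suc a)))
      (cong +_ (ℕₚ.+-suc (suc b) a))
    denominator : + suc b ≡ 1ℤ ℤ.* (+ suc b)
    denominator = ≡.sym (ℤₚ.*-identityˡ (+ suc b))

  onFracs : (P : ℚ⁺ → Set) → (∀ a b .(c : Coprime (suc a) (suc b)) → P (frac a b c)) → ∀ x → P x
  onFracs P h (mkℚ⁺ (mkℚ +[1+ a ] b c)) = h a b c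
  onFracs P h (mkℚ⁺ (mkℚ (+ 0) b c) {{p}}) = ⊥-elim-irr (ℤ.Positive.pos p)
  onFracs P h (mkℚ⁺ (mkℚ ℤ.-[1+ a ] b c) {{p}}) = ⊥-elim-irr (ℤ.Positive.pos p)

codenominator : ℚ⁺ → ℤ
codenominator (mkℚ⁺ x) = + proj₁ (φ ℤ.∣ ℚ.↥ x ∣ (ℚ.↧ₙ x))

codenominator-isCodenominator : IsCodenominator codenominator
codenominator-isCodenominator = record
  { F>0      = λ where (mkℚ⁺ x) → ℤ.positive (ℤ.+<+ (proj₁ (φ-pos ℤ.∣ ℚ.↥ x ∣ (ℚ.↧ₙ x))))
  ; F1       = refl
  ; F[1+1/x] = onFracs _ λ a b c → trans
      (cong codenominator (1+frac b a (sym c)))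
      (cong +_ (trans (cong proj₁ (φ-1+ b a)) (cong proj₂ (φ-swap (suc a) (suc b)))))
  ; F[1/1+x] = onFracs _ λ a b c → trans
      (cong (codenominator ∘ 1/_) (1+frac a b c))
      (cong +_ (trans (cong proj₁ (φ-swap (suc (suc b ℕ.+ a)) (suc b)))
        (trans (cong proj₂ (φ-1+ a b))
          (cong (λ w → proj₁ (φ (suc a) (suc b)) ℕ.+ proj₁ w) (≡.sym (φ-swap (suc a) (suc b)))))))
  }

module _ {F G : ℚ⁺ → ℤ} (F-cod : IsCodenominator F) (G-cod : IsCodenominator G) where
  private
    module F = IsCodenominator F-cod
    module G = IsCodenominator G-cod

    Agree : ℚ⁺ → Set
    Agree x = F x ≡ G x × F (1/ x) ≡ G (1/ x)

    agree-1+ : ∀ a b .(c : Coprime (suc a) (suc b)) → Agree (frac a b c) →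
               Agree (frac (suc b ℕ.+ a) b (coprime-1+ c))
    agree-1+ a b c (Fx≡Gx , F1/x≡G1/x) = subst Agree (1+frac a b c)
      ( trans (F.F[1+1/x] (1/ x)) (trans F1/x≡G1/x (≡.sym (G.F[1+1/x] (1/ x))))
      , trans (F.F[1/1+x] x) (trans (cong₂ ℤ._+_ Fx≡Gx F1/x≡G1/x) (≡.sym (G.F[1/1+x] x))))
      where x = frac a b c

    agree-1 : ∀ a .(c : Coprime (suc a) (suc a)) → Agree (frac a a c)
    agree-1 zero    c = F1≡G1 , F1≡G1
      where F1≡G1 = trans F.F1 (≡.sym G.F1)
    agree-1 (suc a) c = ⊥-elim-irr (absurd (c (∣-refl , ∣-refl)))
      where
      absurd : suc (suc a) ≡ 1 → ⊥
      absurd ()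

    agree : ∀ k a b .(c : Coprime (suc a) (suc b)) → suc a ℕ.+ suc b ℕ.≤ k → Agree (frac a b c)
    agree (suc k) a b c le with ℕ.compare a b
    ... | ℕ.equal a     = agree-1 a c
    ... | ℕ.greater b d = agree-1+ d b (coprime-1+⁻¹ c) (agree k d b (coprime-1+⁻¹ c) (smaller b d le))
    ... | ℕ.less a d    =
      swap (agree-1+ d a (coprime-1+⁻¹ (sym c)) (agree k d a (coprime-1+⁻¹ (sym c)) (smaller′ a d le)))

  codenominator-unique : F ≗ G
  codenominator-unique = onFracs _ λ a b c → proj₁ (agree _ a b c ℕₚ.≤-refl)

{-# OPTIONS --safe #-}

-- For an integer q, F (x + q) is a bilinear expression in (F x , F (1/ x)) and
-- (F q , F (1/ q)), because x ↦ 1ℚ⁺ + x acts on the pair (F x , F (1/ x)) as the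
-- Fibonacci step (u , v) ↦ (v , u + v).  Hence an integer q factors out of the left-hand
-- side, leaving F q times the determinant F (1/ p) F (p + r) - F p F (1/ (p + r)); a second
-- integer, p or r, reduces this determinant to cds F p times F r.
module Submission where

open import Defs
open import Data.Integer.Base as ℤ using (ℤ; +0; +[1+_]; -[1+_]; 1ℤ; _*_; _-_)
import Data.Integer.Properties as ℤₚ
open import Data.Integer.Tactic.RingSolver using (solve-∀)
open import Data.Empty using (⊥-elim-irr)
open import Data.Nat.Base using (ℕ; zero; suc)
open import Data.Nat.Coprimality using (1-coprimeTo; sym)
open import Data.Product.Base using (∃-syntax; _,_)
open import Data.Rational.Base as ℚ using (mkℚ)
import Data.Rational.Properties as ℚₚ
open import Data.Sum.Base using (inj₁; inj₂)
open import Relation.Binary.PropositionalEquality as ≡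
  using (_≡_; refl; cong; cong₂; subst; trans; module ≡-Reasoning)

value-injective : ∀ {x y} → value x ≡ value y → x ≡ y
value-injective refl = refl

+-comm : ∀ x y → x + y ≡ y + x
+-comm x y = value-injective (ℚₚ.+-comm (value x) (value y))

+-assoc : ∀ x y z → x + y + z ≡ x + (y + z)
+-assoc x y z = value-injective (ℚₚ.+-assoc (value x) (value y) (value z))

1/-involutive : ∀ x → 1/ 1/ x ≡ x
1/-involutive (mkℚ⁺ (mkℚ +[1+ _ ] _ _)) = refl
1/-involutive (mkℚ⁺ (mkℚ +0 _ _) {{x>0}}) = ⊥-elim-irr (ℤ.Positive.pos x>0)
1/-involutive (mkℚ⁺ (mkℚ -[1+ _ ] _ _) {{x>0}}) = ⊥-elim-irr (ℤ.Positive.pos x>0)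

+-rightComm : ∀ x y z → x + y + z ≡ x + z + y
+-rightComm x y z =
  trans (+-assoc x y z) (trans (cong (λ w → x + w) (+-comm y z)) (≡.sym (+-assoc x z y)))

x+[1+y]≡[1+x]+y : ∀ x y → x + (1ℚ⁺ + y) ≡ 1ℚ⁺ + x + y
x+[1+y]≡[1+x]+y x y = trans (≡.sym (+-assoc x 1ℚ⁺ y)) (cong (λ w → w + y) (+-comm x 1ℚ⁺))

*-rightComm : ∀ i j k → i * j * k ≡ i * k * j
*-rightComm = solve-∀

-- Stands for the integer `suc n`: the shift makes every index positive. The second argument `0` of
-- `mkℚ` encodes denominator 1.
fromℕ⁺ : ℕ → ℚ⁺
fromℕ⁺ n = mkℚ⁺ (mkℚ +[1+ n ] 0 (sym (1-coprimeTo (suc n))))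

1+fromℕ⁺ : ∀ n → 1ℚ⁺ + fromℕ⁺ n ≡ fromℕ⁺ (suc n)
1+fromℕ⁺ n = value-injective (trans
  (cong (λ k → (1ℤ ℤ.+ k) ℚ./ 1) (ℤₚ.*-identityʳ +[1+ n ]))
  (ℚₚ.↥p/↧p≡p (value (fromℕ⁺ (suc n)))))

integer⇒fromℕ⁺ : ∀ q → IsInteger q → ∃[ n ] q ≡ fromℕ⁺ n
integer⇒fromℕ⁺ q (+[1+ n ] , q≡n/1) =
  n , value-injective (trans q≡n/1 (ℚₚ.↥p/↧p≡p (value (fromℕ⁺ n))))
integer⇒fromℕ⁺ (mkℚ⁺ _ {{x>0}}) (+0 , refl) = ⊥-elim-irr (ℤ.Positive.pos x>0)
-- Unlike `+0 ℚ./ 1`, this quotient does not compute for a variable `n`; positivity becomes absurd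
-- only after rewriting to canonical form.
integer⇒fromℕ⁺ (mkℚ⁺ _ {{x>0}}) (-[1+ n ] , x≡n/1) = ⊥-elim-irr (ℤ.Positive.pos
  (subst ℚ.Positive
    (trans x≡n/1 (ℚₚ.↥p/↧p≡p (mkℚ -[1+ n ] 0 (sym (1-coprimeTo (suc n)))))) x>0))

-- Induction on ℕ carried over to the integers in `ℚ⁺`. The step adds `1ℚ⁺` on the left, as the
-- equations for `F` do.
integer-induction : (P : ℚ⁺ → Set) → P 1ℚ⁺ → (∀ q → P q → P (1ℚ⁺ + q)) →
                    ∀ q → IsInteger q → P q
integer-induction P P1 P1+ q q-int with n , refl ← integer⇒fromℕ⁺ q q-int = go n
  where
  go : ∀ n → P (fromℕ⁺ n)
  go zero    = P1
  go (suc n) = subst P (1+fromℕ⁺ n) (P1+ (fromℕ⁺ n) (go n))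

module _ {F : ℚ⁺ → ℤ} (F-cod : IsCodenominator F) where
  open IsCodenominator F-cod

  F[1+x] : ∀ x → F (1ℚ⁺ + x) ≡ F (1/ x)
  F[1+x] x = trans (cong (λ y → F (1ℚ⁺ + y)) (≡.sym (1/-involutive x))) (F[1+1/x] (1/ x))

  -- Fibonacci addition law: for integral `q`, `F q` and `F (1/ q)` are consecutive Fibonacci
  -- numbers, and `F (1/ x) - F x` is the term preceding `F x` in the sequence continuing
  -- `F x , F (1/ x)`. The claim keeps `x` general because the induction step moves a unit from `q`
  -- to `x`.
  F[x+q] : ∀ q → IsInteger q → ∀ x → F (x + q) ≡ F x * F (1/ q) ℤ.+ (F (1/ x) - F x) * F q
  F[x+q] = integer-induction _ base step
    where
    open ≡-Reasoning

    base-algebra : ∀ u v → v ≡ u * 1ℤ ℤ.+ (v - u) * 1ℤ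
    base-algebra = solve-∀

    base : ∀ x → F (x + 1ℚ⁺) ≡ F x * F (1/ 1ℚ⁺) ℤ.+ (F (1/ x) - F x) * F 1ℚ⁺
    base x = begin
      F (x + 1ℚ⁺)                                       ≡⟨ cong F (+-comm x 1ℚ⁺) ⟩
      F (1ℚ⁺ + x)                                       ≡⟨ F[1+x] x ⟩
      F (1/ x)                                          ≡⟨ base-algebra (F x) (F (1/ x)) ⟩
      F x * 1ℤ ℤ.+ (F (1/ x) - F x) * 1ℤ
        -- `1/ 1ℚ⁺` computes to `1ℚ⁺`, so `F1` evaluates both factors at once.
        ≡⟨ cong (λ w → F x * w ℤ.+ (F (1/ x) - F x) * w) F1 ⟨
      F x * F 1ℚ⁺ ℤ.+ (F (1/ x) - F x) * F 1ℚ⁺          ∎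

    step-algebra : ∀ u v a b →
      v * b ℤ.+ ((u ℤ.+ v) - v) * a ≡ u * (a ℤ.+ b) ℤ.+ (v - u) * b
    step-algebra = solve-∀

    step : ∀ q → (∀ x → F (x + q) ≡ F x * F (1/ q) ℤ.+ (F (1/ x) - F x) * F q) →
           ∀ x → F (x + (1ℚ⁺ + q)) ≡
             F x * F (1/ (1ℚ⁺ + q)) ℤ.+ (F (1/ x) - F x) * F (1ℚ⁺ + q)
    step q ih x = begin
      F (x + (1ℚ⁺ + q))
        ≡⟨ cong F (x+[1+y]≡[1+x]+y x q) ⟩
      F (1ℚ⁺ + x + q)
        ≡⟨ ih (1ℚ⁺ + x) ⟩
      F (1ℚ⁺ + x) * F (1/ q) ℤ.+ (F (1/ (1ℚ⁺ + x)) - F (1ℚ⁺ + x)) * F q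
        ≡⟨ cong₂ (λ s t → s * F (1/ q) ℤ.+ (t - s) * F q) (F[1+x] x) (F[1/1+x] x) ⟩
      F (1/ x) * F (1/ q) ℤ.+ ((F x ℤ.+ F (1/ x)) - F (1/ x)) * F q
        ≡⟨ step-algebra (F x) (F (1/ x)) (F q) (F (1/ q)) ⟩
      F x * (F q ℤ.+ F (1/ q)) ℤ.+ (F (1/ x) - F x) * F (1/ q)
        ≡⟨ cong₂ (λ s t → F x * s ℤ.+ (F (1/ x) - F x) * t) (F[1/1+x] q) (F[1+x] q) ⟨
      F x * F (1/ (1ℚ⁺ + q)) ℤ.+ (F (1/ x) - F x) * F (1ℚ⁺ + q) ∎

  -- No second induction: `F[1+x]` turns the reciprocal into a further unit, which is absorbed into
  -- `x` before `F[x+q]` applies.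
  F[1/x+q] : ∀ q → IsInteger q → ∀ x → F (1/ (x + q)) ≡ F (1/ x) * F (1/ q) ℤ.+ F x * F q
  F[1/x+q] q q-int x = begin
    F (1/ (x + q))        ≡⟨ F[1+x] (x + q) ⟨
    F (1ℚ⁺ + (x + q))     ≡⟨ cong F (+-assoc 1ℚ⁺ x q) ⟨
    F (1ℚ⁺ + x + q)       ≡⟨ F[x+q] q q-int (1ℚ⁺ + x) ⟩
    F (1ℚ⁺ + x) * F (1/ q) ℤ.+ (F (1/ (1ℚ⁺ + x)) - F (1ℚ⁺ + x)) * F q
      ≡⟨ cong₂ (λ s t → s * F (1/ q) ℤ.+ (t - s) * F q) (F[1+x] x) (F[1/1+x] x) ⟩
    F (1/ x) * F (1/ q) ℤ.+ ((F x ℤ.+ F (1/ x)) - F (1/ x)) * F q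
      ≡⟨ algebra (F x) (F (1/ x)) (F q) (F (1/ q)) ⟩
    F (1/ x) * F (1/ q) ℤ.+ F x * F q ∎
    where
    open ≡-Reasoning
    algebra : ∀ u v a b → v * b ℤ.+ ((u ℤ.+ v) - v) * a ≡ v * b ℤ.+ u * a
    algebra = solve-∀

  det : ℚ⁺ → ℚ⁺ → ℤ
  det p r = F (1/ p) * F (p + r) - F p * F (1/ (p + r))

  -- Moving `q` last lets `F[x+q]` expand at both `p` and `p + r`; the `F (1/ q)` terms then cancel.
  factor-integer : ∀ p q r → IsInteger q →
    F (p + q) * F (p + r) - F p * F (p + q + r) ≡ det p r * F q
  factor-integer p q r q-int = begin
    F (p + q) * F (p + r) - F p * F (p + q + r)
      ≡⟨ cong₂ (λ s t → s * F (p + r) - F p * t) (F[x+q] q q-int p)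
           (trans (cong F (+-rightComm p q r)) (F[x+q] q q-int (p + r))) ⟩
    (F p * F (1/ q) ℤ.+ (F (1/ p) - F p) * F q) * F (p + r) -
      F p * (F (p + r) * F (1/ q) ℤ.+ (F (1/ (p + r)) - F (p + r)) * F q)
      ≡⟨ algebra (F p) (F (1/ p)) (F q) (F (1/ q)) (F (p + r)) (F (1/ (p + r))) ⟩
    det p r * F q ∎
    where
    open ≡-Reasoning
    algebra : ∀ u v a b s t →
      (u * b ℤ.+ (v - u) * a) * s - u * (s * b ℤ.+ (t - s) * a) ≡ (v * s - u * t) * a
    algebra = solve-∀

  -- Expanding around `p` cancels the `F (1/ r)` terms and leaves a quadratic form in `F p` and
  -- `F (1/ p)`.
  det-integerʳ : ∀ p r → IsInteger r → det p r ≡ cds F p * F r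
  det-integerʳ p r r-int = trans
    (cong₂ (λ s t → F (1/ p) * s - F p * t) (F[x+q] r r-int p) (F[1/x+q] r r-int p))
    (algebra (F p) (F (1/ p)) (F r) (F (1/ r)))
    where
    -- The factors `v * 1ℤ` and `u * 1ℤ` match the unfolding of the squares in `cds`.
    algebra : ∀ u v c d →
      v * (u * d ℤ.+ (v - u) * c) - u * (v * d ℤ.+ u * c) ≡
      (v * (v * 1ℤ) - u * v - u * (u * 1ℤ)) * c
    algebra = solve-∀

  -- Here `p + r` is read as `r + p` and expanded around `r`; again the `F (1/ r)` terms cancel.
  det-integerˡ : ∀ p r → IsInteger p → det p r ≡ cds F p * F r
  det-integerˡ p r p-int = trans
    (cong₂ (λ s t → F (1/ p) * s - F p * t)
      (trans (cong F (+-comm p r)) (F[x+q] p p-int r))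
      (trans (cong (λ x → F (1/ x)) (+-comm p r)) (F[1/x+q] p p-int r)))
    (algebra (F p) (F (1/ p)) (F r) (F (1/ r)))
    where
    algebra : ∀ u v c d →
      v * (c * v ℤ.+ (d - c) * u) - u * (d * v ℤ.+ c * u) ≡
      (v * (v * 1ℤ) - u * v - u * (u * 1ℤ)) * c
    algebra = solve-∀

  two-integers : ∀ p q r → IsInteger q → det p r ≡ cds F p * F r →
    F (p + q) * F (p + r) - F p * F (p + q + r) ≡ cds F p * F q * F r
  two-integers p q r q-int det≡ = begin
    F (p + q) * F (p + r) - F p * F (p + q + r) ≡⟨ factor-integer p q r q-int ⟩
    det p r * F q                               ≡⟨ cong (_* F q) det≡ ⟩
    cds F p * F r * F q                         ≡⟨ *-rightComm (cds F p) (F r) (F q) ⟩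
    cds F p * F q * F r                         ∎
    where open ≡-Reasoning

  swap-qr : ∀ p q r →
    F (p + r) * F (p + q) - F p * F (p + r + q) ≡ cds F p * F r * F q →
    F (p + q) * F (p + r) - F p * F (p + q + r) ≡ cds F p * F q * F r
  swap-qr p q r eq = begin
    F (p + q) * F (p + r) - F p * F (p + q + r)
      ≡⟨ cong₂ (λ s x → s - F p * F x) (ℤₚ.*-comm (F (p + q)) _) (+-rightComm p q r) ⟩
    F (p + r) * F (p + q) - F p * F (p + r + q) ≡⟨ eq ⟩
    cds F p * F r * F q                         ≡⟨ *-rightComm (cds F p) (F r) (F q) ⟩
    cds F p * F q * F r                         ∎
    where open ≡-Reasoning

theorem2 : (F : ℚ⁺ → ℤ) → IsCodenominator F →
    (p q r : ℚ⁺) → AtLeastTwoIntegers p q r →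
    F (p + q) * F (p + r) - F p * F (p + q + r) ≡ cds F p * F q * F r
theorem2 F F-cod p q r (inj₁ (p-int , q-int)) =
  two-integers F-cod p q r q-int (det-integerˡ F-cod p r p-int)
-- The integer to factor out is now `r`, so the identity is proved with `q` and `r` exchanged and
-- transported back by symmetry.
theorem2 F F-cod p q r (inj₂ (inj₁ (p-int , r-int))) =
  swap-qr F-cod p q r (two-integers F-cod p r q r-int (det-integerˡ F-cod p q p-int))
theorem2 F F-cod p q r (inj₂ (inj₂ (q-int , r-int))) =
  two-integers F-cod p q r q-int (det-integerʳ F-cod p r r-int)
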